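{- Let $p,q$ be positive integers, let $n,t$ be integers with $0\leq t\leq q$, and let $b_1 \leq b_2 \leq \ldots \leq b_n$ be positive integers. For a positive integer $k$ define $N(k)=(q+1)(\lceil q/p\rceil+3)^{k-1}$ if $k\leq p$ and $N(k)=(2(p+q+1))^k$ if $k>p$. Assume there exists a positive integer $k$ such that (i) $\gcd(p+q,\ell)\leq p$ for every $1\leq \ell \leq k$; (ii) $n\geq N(k)$; (iii) $b_{N(k)} \leq k$. Then Enforcer has a winning strategy in the game $mBox(b_1, \ldots, b_n,(p,q))$ as the first player, even if in his first move he claims only $t$ elements (instead of $q$).
   Context: A $(p,q)$ Avoider-Enforcer game (strict rules): Avoider and Enforcer alternately claim exactly $p$ and exactly $q$ previously unclaimed board elements per move, respectively; a player facing fewer unclaimed elements than his bias claims all of them; the game ends when all elements are claimed; Avoider loses (Enforcer wins) if at the end Avoider has claimed all elements of some target set. $mBox(b_1,\ldots,b_n,(p,q))$ is this game on the disjoint union of pairwise disjoint boxes $B_1,\ldots,B_n$ with $|B_i|=b_i$, with target sets exactly $B_1,\ldots,B_n$. -}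

module Defs where

open import Data.Nat using (ℕ; zero; suc; _+_; _*_; _∸_; _^_; _≤_; _<_; _≤ᵇ_; NonZero)
open import Data.Nat.DivMod using (_/_)
open import Data.Bool using (Bool; true; false; if_then_else_)
open import Data.Fin using (Fin)
open import Data.Vec using (Vec; []; _∷_; lookup; tabulate; replicate; _++_; map; sum)
open import Data.Fin.Subset using (Subset; inside; outside; _∈_; ∣_∣)
open import Data.Fin.Subset.Properties using (_∈?_)
open import Data.Product using (Σ; _×_)
open import Relation.Binary.PropositionalEquality using (_≡_)
open import Relation.Nullary using (yes; no)

data Owner : Set where
  free avoider enforcer : Owner

Position : ℕ → Set
Position M = Vec Owner M

nfree : ∀ {M} → Position M → ℕ
nfree [] = 0
nfree (free ∷ s) = suc (nfree s)
nfree (avoider ∷ s) = nfree s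
nfree (enforcer ∷ s) = nfree s

min : ℕ → ℕ → ℕ
min a b = if a ≤ᵇ b then a else b

LegalMove : ∀ {M} → ℕ → Position M → Subset M → Set
LegalMove r s m = (∀ x → x ∈ m → lookup s x ≡ free) × (∣ m ∣ ≡ min r (nfree s))

apply : ∀ {M} → Owner → Subset M → Position M → Position M
apply o m s = tabulate λ x → helper x
  where
  helper : _ → Owner
  helper x with x ∈? m
  ... | yes _ = o
  ... | no _ = lookup s x

AvoiderOwnsTarget : ∀ {M n} → (Fin n → Subset M) → Position M → Set
AvoiderOwnsTarget {n = n} T s = Σ (Fin n) λ i → ∀ x → x ∈ T i → lookup s x ≡ avoider

-- whose turn it is; Enforcer's turn carries the bias of his current move
data Turn : Set where
  enforcerTurn : ℕ → Turn
  avoiderTurn  : Turn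

data EnforcerWins {M n : ℕ} (p q : ℕ) (T : Fin n → Subset M)
     : Turn → Position M → Set where
  gameOver : ∀ {turn s} → nfree s ≡ 0 → AvoiderOwnsTarget T s →
             EnforcerWins p q T turn s
  enfMove  : ∀ {r s} → 0 < nfree s → (m : Subset M) → LegalMove r s m →
             EnforcerWins p q T avoiderTurn (apply enforcer m s) →
             EnforcerWins p q T (enforcerTurn r) s
  avoMove  : ∀ {s} → 0 < nfree s →
             (∀ m → LegalMove p s m →
                    EnforcerWins p q T (enforcerTurn q) (apply avoider m s)) →
             EnforcerWins p q T avoiderTurn s

-- Boxes: the board Fin (sum b) is cut into consecutive disjoint blocks
-- of sizes b₁,…,bₙ; block i is the i-th target set.

boxes : ∀ {n} (b : Vec ℕ n) → Vec (Subset (sum b)) n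
boxes [] = []
boxes (x ∷ b) = (replicate x inside ++ replicate (sum b) outside)
              ∷ map (replicate x outside ++_) (boxes b)

emptyPosition : (M : ℕ) → Position M
emptyPosition M = replicate M free

EnforcerWinsMBoxFirst : ∀ {n} → (b : Vec ℕ n) → (p q t : ℕ) → Set
EnforcerWinsMBoxFirst {n} b p q t =
  EnforcerWins p q (lookup (boxes b)) (enforcerTurn t) (emptyPosition (sum b))

ceilDiv : (a d : ℕ) → .{{NonZero d}} → ℕ
ceilDiv a d = (a + d ∸ 1) / d

Nk : (p q : ℕ) → .{{NonZero p}} → ℕ → ℕ
Nk p q k = if k ≤ᵇ p
           then (q + 1) * (ceilDiv q p + 3) ^ (k ∸ 1)
           else (2 * (p + q + 1)) ^ k

{-# OPTIONS --safe #-}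
module Submission where

-- Enforcer keeps a set of boxes in play, all free of his marks. He claims abandoned elements
-- (those of the other boxes) while there are any, and otherwise abandons a box with the most
-- free elements, starting with all boxes larger than k. Since Avoider loses once a box in play
-- is used up, it suffices that some box always stays in play. Give a box with f free elements
-- the value w^(k - f); it is multiplied by w whenever Avoider claims in the box.
--
-- For k ≤ p, after Enforcer abandons boxes of at most s free elements, fewer than s abandoned
-- elements remain, so Avoider makes at least p - s + 1 claims in boxes in play, and
-- w = ⌈q/p⌉ + 3 makes them outweigh the abandoned boxes: each move pair restores the potential.
--
-- For k > p Avoider may stay on abandoned elements for a while. As long as he does, the number of
-- abandoned elements changes by p + q modulo the current box size s per move pair, and
-- gcd(p + q, s) ≤ p makes it fall below p before p + q boxes are abandoned; then Avoider has to
-- claim in a box in play, whose gain with w = 2(p + q + 1) pays for all of them.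

open import Defs
open import Data.Bool using (true; false; if_then_else_; T)
open import Data.Bool.Properties using (if-float)
open import Data.Nat
  using (ℕ; zero; suc; _+_; _*_; _∸_; _^_; _≤_; _<_; z≤n; s≤s; s≤s⁻¹; NonZero; >-nonZero⁻¹; _≤ᵇ_)
open import Data.Nat.DivMod
  using (_/_; _%_; m*n%n≡0; m≡m%n+[m/n]*n; m%n<n; m%n%n≡m%n; m<n⇒m%n≡m; [m+kn]%n≡m%n; %-distribˡ-*)
open import Data.Nat.GCD using (gcd; gcd-GCD; gcd[m,n]≡0⇒m≡0; module Bézout)
open import Data.Nat.Properties
open import Data.Nat.Tactic.RingSolver using (solve-∀)
open import Data.Fin using (Fin; toℕ; fromℕ<; zero; suc; splitAt; _↑ˡ_; _↑ʳ_)
open import Data.Fin as F using ()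
open import Data.Fin.Properties using (splitAt⁻¹-↑ˡ; splitAt⁻¹-↑ʳ; toℕ-fromℕ<)
open import Data.Fin.Subset using (Subset; inside; outside; _∈_; ∣_∣; ⊥)
open import Data.Fin.Subset.Properties using (_∈?_; ∣⊥∣≡0)
open import Data.Product using (Σ; ∃; ∃₂; _×_; _,_; proj₂)
open import Data.Sum using (inj₁; inj₂)
open import Data.Unit using (tt)
open import Data.Vec
  using (Vec; []; _∷_; lookup; replicate; tabulate; zipWith; map; sum; _++_; _[_]≔_)
open import Data.Vec.Properties
open import Function using (_∘_)
open import Relation.Binary.PropositionalEquality
  using (_≡_; _≢_; refl; sym; trans; cong; cong₂; subst; module ≡-Reasoning)
open import Relation.Nullary using (¬_; yes; no; contradiction)

-- Positions and sets of claimed elements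

min-suc : ∀ a b → min (suc a) (suc b) ≡ suc (min a b)
min-suc zero    b = refl
min-suc (suc a) b = sym (if-float suc (suc a ≤ᵇ b))

min-zeroʳ : ∀ a → min a 0 ≡ 0
min-zeroʳ zero    = refl
min-zeroʳ (suc a) = refl

-- `apply` tabulates a membership test; this form recurses along the two vectors, so single
-- insertions and removals can be handled by induction.
claim : ∀ {M} → Owner → Subset M → Position M → Position M
claim o = zipWith λ c a → if c then o else a

apply≡claim : ∀ {M} o (m : Subset M) s → apply o m s ≡ claim o m s
apply≡claim o m s = trans (tabulate-cong pointwise) (tabulate∘lookup (claim o m s))
  where
  -- The local function of 'apply' has no name here: unification recovers it.
  entries : ∀ {n} {f : Fin n → Owner} {v} → v ≡ tabulate f → Fin n → Owner
  entries {f = f} _ = f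

  pointwise : ∀ x → entries {v = apply o m s} refl x ≡ lookup (claim o m s) x
  pointwise x rewrite lookup-zipWith (λ c a → if c then o else a) x m s
    with x ∈? m
  ... | yes x∈m rewrite []=⇒lookup x∈m = refl
  ... | no  x∉m with lookup m x in eq
  ...   | inside  = contradiction (lookup⇒[]= x m eq) x∉m
  ...   | outside = refl

claim-nothing : ∀ {M} o (m : Subset M) s → ∣ m ∣ ≡ 0 → claim o m s ≡ s
claim-nothing o []            []      _ = refl
claim-nothing o (outside ∷ m) (a ∷ s) e = cong (a ∷_) (claim-nothing o m s e)

claim-insert : ∀ {M} o (m : Subset M) s x →
               claim o (m [ x ]≔ inside) s ≡ claim o m s [ x ]≔ o
claim-insert o (_ ∷ m) (_ ∷ s) zero    = refl
claim-insert o (_ ∷ m) (_ ∷ s) (suc x) = cong (_ ∷_) (claim-insert o m s x)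

claim-remove : ∀ {M} o (m : Subset M) s x → lookup m x ≡ inside →
               claim o m s ≡ claim o (m [ x ]≔ outside) (s [ x ]≔ o)
claim-remove o (inside ∷ m) (_ ∷ s) zero    refl = refl
claim-remove o (_ ∷ m)      (_ ∷ s) (suc x) e    = cong (_ ∷_) (claim-remove o m s x e)

∣insert∣ : ∀ {M} (m : Subset M) x → lookup m x ≡ outside →
           ∣ m [ x ]≔ inside ∣ ≡ suc ∣ m ∣
∣insert∣ (outside ∷ m) zero    refl = refl
∣insert∣ (inside  ∷ m) (suc x) e    = cong suc (∣insert∣ m x e)
∣insert∣ (outside ∷ m) (suc x) e    = ∣insert∣ m x e

∣remove∣ : ∀ {M} (m : Subset M) x → lookup m x ≡ inside →
           ∣ m ∣ ≡ suc ∣ m [ x ]≔ outside ∣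
∣remove∣ (inside  ∷ m) zero    refl = refl
∣remove∣ (inside  ∷ m) (suc x) e    = cong suc (∣remove∣ m x e)
∣remove∣ (outside ∷ m) (suc x) e    = ∣remove∣ m x e

∃-member : ∀ {M r} (m : Subset M) → ∣ m ∣ ≡ suc r → ∃ λ x → lookup m x ≡ inside
∃-member (inside  ∷ m) e = zero , refl
∃-member (outside ∷ m) e with x , x∈m ← ∃-member m e = suc x , x∈m

∃-free : ∀ {M r} (s : Position M) → nfree s ≡ suc r → ∃ λ x → lookup s x ≡ free
∃-free (free     ∷ s) e = zero , refl
∃-free (avoider  ∷ s) e with x , h ← ∃-free s e = suc x , h
∃-free (enforcer ∷ s) e with x , h ← ∃-free s e = suc x , h

nfree-claim : ∀ {M} {o} (s : Position M) x → o ≢ free → lookup s x ≡ free →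
              nfree s ≡ suc (nfree (s [ x ]≔ o))
nfree-claim {o = free}     (free ∷ s)     zero    o≢ refl = contradiction refl o≢
nfree-claim {o = avoider}  (free ∷ s)     zero    o≢ refl = refl
nfree-claim {o = enforcer} (free ∷ s)     zero    o≢ refl = refl
nfree-claim                (free ∷ s)     (suc x) o≢ h    = cong suc (nfree-claim s x o≢ h)
nfree-claim                (avoider ∷ s)  (suc x) o≢ h    = nfree-claim s x o≢ h
nfree-claim                (enforcer ∷ s) (suc x) o≢ h    = nfree-claim s x o≢ h

positive⇒suc : ∀ {k} → 0 < k → ∃ λ r → k ≡ suc r
positive⇒suc (s≤s _) = _ , refl

-- Reduction of moves to single claims

data Player : Set where
  E A : Player

-- The game refined to single claims: 'Play σ j s' says that Enforcer wins from s
-- when player σ still has to claim j elements in the current move.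
data Play {M n} (p q : ℕ) (T : Fin n → Subset M) : Player → ℕ → Position M → Set where
  over      : ∀ {σ j s} → nfree s ≡ 0 → AvoiderOwnsTarget T s → Play p q T σ j s
  pass-E    : ∀ {s} → Play p q T A p s → Play p q T E 0 s
  pass-A    : ∀ {s} → Play p q T E q s → Play p q T A 0 s
  claim-E   : ∀ {j s} x → lookup s x ≡ free →
              Play p q T E j (s [ x ]≔ enforcer) → Play p q T E (suc j) s
  claim-A   : ∀ {j s} → 0 < nfree s →
              (∀ x → lookup s x ≡ free → Play p q T A j (s [ x ]≔ avoider)) →
              Play p q T A (suc j) s

module _ {M n p q : ℕ} {T : Fin n → Subset M} where

  -- On a full board no claim is possible, so the derivation is a finite chain of passes that ends
  -- in `over`.
  owned : ∀ {σ j s} → nfree s ≡ 0 → Play p q T σ j s → AvoiderOwnsTarget T s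
  owned e (over _ w)      = w
  owned e (pass-E P)      = owned e P
  owned e (pass-A P)      = owned e P
  owned {s = s} e (claim-E x h P) = contradiction
    (trans (sym e) (nfree-claim {o = enforcer} s x (λ ()) h)) λ ()
  owned e (claim-A pos _) = contradiction (sym e) (<⇒≢ pos)

  private
    free-claim : ∀ (m : Subset M) s x → lookup (claim enforcer m s) x ≡ free →
                 lookup m x ≡ outside × lookup s x ≡ free
    free-claim m s x h
      rewrite lookup-zipWith (λ c a → if c then enforcer else a) x m s
      with lookup m x
    ... | outside = refl , h

    insert-legal : ∀ (m : Subset M) s x → lookup s x ≡ free →
                   (∀ y → y ∈ m → lookup s y ≡ free) →
                   ∀ y → y ∈ m [ x ]≔ inside → lookup s y ≡ free
    insert-legal m s x h legal y y∈ with y F.≟ x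
    ... | yes refl = h
    ... | no  y≢x  = legal y (lookup⇒[]= y m
                       (trans (sym (lookup∘update′ y≢x m inside)) ([]=⇒lookup y∈)))

    remove-legal : ∀ {o} (m : Subset M) s x → (∀ y → y ∈ m → lookup s y ≡ free) →
                   ∀ y → y ∈ m [ x ]≔ outside → lookup (s [ x ]≔ o) y ≡ free
    remove-legal m s x legal y y∈ with y F.≟ x
    ... | yes refl = contradiction
                       (trans (sym (lookup∘update x m outside)) ([]=⇒lookup y∈)) λ ()
    ... | no  y≢x  = trans (lookup∘update′ y≢x s _) (legal y (lookup⇒[]= y m
                       (trans (sym (lookup∘update′ y≢x m outside)) ([]=⇒lookup y∈))))

  enforcerWins : ∀ {j s} → Play p q T E j s → EnforcerWins p q T (enforcerTurn j) s
  avoiderLoses : ∀ {s} → Play p q T A p s → EnforcerWins p q T avoiderTurn s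

  -- m collects what Enforcer has claimed since the start s₀ of his move.
  finishMove : ∀ {j r s s₀} → Play p q T E j s → 0 < nfree s₀ →
               (m : Subset M) → (∀ x → x ∈ m → lookup s₀ x ≡ free) →
               claim enforcer m s₀ ≡ s →
               ∣ m ∣ + min j (nfree s) ≡ min r (nfree s₀) →
               EnforcerWins p q T (enforcerTurn r) s₀
  -- `claim-A` has a continuation for every free element, so the members of Avoider's set can be
  -- split off in any order.
  answer     : ∀ {j s} → Play p q T A j s → (m : Subset M) → LegalMove j s m →
               EnforcerWins p q T (enforcerTurn q) (claim avoider m s)

  enforcerWins {j} {s} P with nfree s in e
  ... | zero  = gameOver e (owned e P)
  ... | suc r = finishMove P (subst (0 <_) (sym e) (s≤s z≤n)) ⊥
    (λ x x∈ → contradiction (trans (sym (lookup-replicate x outside)) ([]=⇒lookup x∈)) λ ())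
    (claim-nothing enforcer ⊥ s (∣⊥∣≡0 M))
    (cong (_+ min j (nfree s)) (∣⊥∣≡0 M))

  avoiderLoses {s} P with nfree s in e
  ... | zero  = gameOver e (owned e P)
  ... | suc r = avoMove (subst (0 <_) (sym e) (s≤s z≤n))
    λ m legal → subst (EnforcerWins p q T (enforcerTurn q))
                      (sym (apply≡claim avoider m s)) (answer P m legal)

  finishMove {j} {s₀ = s₀} (over e w) pos m legal refl size =
    enfMove pos m
      -- The board is full, so `min j 0` vanishes and a move cut short still has the legal size.
      (legal , trans (sym (trans (cong (∣ m ∣ +_) (trans (cong (min j) e) (min-zeroʳ j)))
                                 (+-identityʳ _))) size)
      (subst (EnforcerWins p q T avoiderTurn) (sym (apply≡claim enforcer m s₀))
             (gameOver e w))
  finishMove {s₀ = s₀} (pass-E P) pos m legal refl size =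
    enfMove pos m (legal , trans (sym (+-identityʳ _)) size)
      (subst (EnforcerWins p q T avoiderTurn) (sym (apply≡claim enforcer m s₀)) (avoiderLoses P))
  finishMove {suc j} {s₀ = s₀} (claim-E {s = s} x h P) pos m legal refl size
    with x∉m , h₀ ← free-claim m s₀ x h =
    finishMove P pos (m [ x ]≔ inside) (insert-legal m s₀ x h₀ legal)
      (claim-insert enforcer m s₀ x)
      (trans (cong (_+ min j (nfree (s [ x ]≔ enforcer))) (∣insert∣ m x x∉m))
        (trans (sym (+-suc ∣ m ∣ _)) (trans (cong (∣ m ∣ +_)
          (trans (sym (min-suc j _)) (cong (min (suc j)) (sym (nfree-claim s x (λ ()) h))))) size)))

  answer {j} {s} (over e w) m (_ , size) = subst (EnforcerWins p q T (enforcerTurn q))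
    (sym (claim-nothing avoider m s (trans size (trans (cong (min j) e) (min-zeroʳ j)))))
    (gameOver e w)
  answer {s = s} (pass-A P) m (_ , size) = subst (EnforcerWins p q T (enforcerTurn q))
    (sym (claim-nothing avoider m s size)) (enforcerWins P)
  answer {suc j} {s} (claim-A pos P) m (legal , size)
    with r , e ← positive⇒suc pos
    with x , x∈m ← ∃-member m (trans size (trans (cong (min (suc j)) e) (min-suc j r)))
    with h ← legal x (lookup⇒[]= x m x∈m) =
    subst (EnforcerWins p q T (enforcerTurn q)) (sym (claim-remove avoider m s x x∈m))
      (answer (P x h) (m [ x ]≔ outside) (remove-legal m s x legal ,
        suc-injective (trans (sym (∣remove∣ m x x∈m)) (trans size
          (trans (cong (min (suc j)) (nfree-claim s x (λ ()) h)) (min-suc j _))))))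

-- Boxes in play and abandoned boxes

-- L lists, for each box without marks of Enforcer that is still in play, its (positive)
-- number of free elements, and has 0 for the abandoned boxes; u counts the free elements
-- of the abandoned boxes.
data Config : ∀ {n} (b : Vec ℕ n) → Position (sum b) → ℕ → Vec ℕ n → Set where
  []   : Config [] [] 0 []
  dead : ∀ {n x u u′} {b L : Vec ℕ n} {s₂} (s₁ : Position x) → u′ ≡ nfree s₁ + u →
         Config b s₂ u L → Config (x ∷ b) (s₁ ++ s₂) u′ (0 ∷ L)
  live : ∀ {n x u l} {b L : Vec ℕ n} {s₂} (s₁ : Position x) →
         (∀ y → lookup s₁ y ≢ enforcer) → nfree s₁ ≡ suc l →
         Config b s₂ u L → Config (x ∷ b) (s₁ ++ s₂) u (suc l ∷ L)

module _ {n x : ℕ} {b : Vec ℕ n} (s₁ : Position x) (s₂ : Position (sum b)) where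

  owned-head : (∀ y → lookup s₁ y ≡ avoider) →
               AvoiderOwnsTarget (lookup (boxes (x ∷ b))) (s₁ ++ s₂)
  owned-head h = zero , all
    where
    all : ∀ z → z ∈ lookup (boxes (x ∷ b)) zero → lookup (s₁ ++ s₂) z ≡ avoider
    all z z∈ with splitAt x z in eq
    ... | inj₁ y with refl ← splitAt⁻¹-↑ˡ eq = trans (lookup-++ˡ s₁ s₂ y) (h y)
    ... | inj₂ y with refl ← splitAt⁻¹-↑ʳ {m = x} eq = contradiction
      (trans (sym (trans (lookup-++ʳ (replicate x inside) _ y) (lookup-replicate y outside)))
             ([]=⇒lookup z∈)) λ ()

  owned-tail : AvoiderOwnsTarget (lookup (boxes b)) s₂ →
               AvoiderOwnsTarget (lookup (boxes (x ∷ b))) (s₁ ++ s₂)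
  owned-tail (i , h) = suc i , all
    where
    shifted : lookup (boxes (x ∷ b)) (suc i) ≡ replicate x outside ++ lookup (boxes b) i
    shifted = lookup-map i (replicate x outside ++_) (boxes b)

    all : ∀ z → z ∈ lookup (boxes (x ∷ b)) (suc i) → lookup (s₁ ++ s₂) z ≡ avoider
    all z z∈ with z∈′ ← subst (z ∈_) shifted z∈ with splitAt x z in eq
    ... | inj₁ y with refl ← splitAt⁻¹-↑ˡ eq = contradiction
      (trans (sym (trans (lookup-++ˡ (replicate x outside) _ y) (lookup-replicate y outside)))
             ([]=⇒lookup z∈′)) λ ()
    ... | inj₂ y with refl ← splitAt⁻¹-↑ʳ {m = x} eq = trans (lookup-++ʳ s₁ s₂ y)
      (h y (lookup⇒[]= y _ (trans (sym (lookup-++ʳ (replicate x outside) _ y)) ([]=⇒lookup z∈′))))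

owned-persists : ∀ {M n} {T : Fin n → Subset M} (s : Position M) {o} x → lookup s x ≡ free →
                 AvoiderOwnsTarget T s → AvoiderOwnsTarget T (s [ x ]≔ o)
owned-persists s x h (i , own) = i , λ y y∈ → trans
  (lookup∘update′ (λ { refl → contradiction (trans (sym h) (own y y∈)) λ () }) s _) (own y y∈)

all-avoider : ∀ {x} (s : Position x) → nfree s ≡ 0 → (∀ y → lookup s y ≢ enforcer) →
              ∀ y → lookup s y ≡ avoider
all-avoider (avoider  ∷ s) e ne zero    = refl
all-avoider (avoider  ∷ s) e ne (suc y) = all-avoider s e (ne ∘ suc) y
all-avoider (enforcer ∷ s) e ne _       = contradiction refl (ne zero)

avoider≢enforcer : ∀ {x} (s : Position x) z → (∀ y → lookup s y ≢ enforcer) →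
                   ∀ y → lookup (s [ z ]≔ avoider) y ≢ enforcer
avoider≢enforcer s z ne y h with y F.≟ z
... | yes refl = contradiction (trans (sym (lookup∘update z s avoider)) h) λ ()
... | no  y≢z  = ne y (trans (sym (lookup∘update′ y≢z s avoider)) h)

enforcer-outside : ∀ {n u} {b L : Vec ℕ n} {s} → Config b s (suc u) L →
                   ∃ λ x → lookup s x ≡ free × Config b (s [ x ]≔ enforcer) u L
enforcer-outside (live {s₂ = s₂} s₁ ne e c) with y , h , c′ ← enforcer-outside c =
  _ ↑ʳ y , trans (lookup-++ʳ s₁ s₂ y) h ,
  subst (λ s → Config _ s _ _) (sym ([]≔-++-↑ʳ s₁ s₂ y)) (live s₁ ne e c′)
enforcer-outside (dead {s₂ = s₂} s₁ e c) with nfree s₁ in e₁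
enforcer-outside (dead {s₂ = s₂} s₁ refl c) | zero with y , h , c′ ← enforcer-outside c =
  _ ↑ʳ y , trans (lookup-++ʳ s₁ s₂ y) h ,
  subst (λ s → Config _ s _ _) (sym ([]≔-++-↑ʳ s₁ s₂ y)) (dead s₁ (cong (_+ _) (sym e₁)) c′)
enforcer-outside (dead {u = u} {s₂ = s₂} s₁ refl c) | suc r with y , h ← ∃-free s₁ e₁ =
  y ↑ˡ _ , trans (lookup-++ˡ s₁ s₂ y) h ,
  subst (λ s → Config _ s _ _) (sym ([]≔-++-↑ˡ s₁ s₂ y)) (dead (s₁ [ y ]≔ enforcer)
    (cong (_+ u) (suc-injective (trans (sym e₁) (nfree-claim s₁ y (λ ()) h)))) c)

enforcer-break : ∀ {n u l} {b L : Vec ℕ n} {s} → Config b s u L →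
                 ∀ i → lookup L i ≡ suc l →
                 ∃ λ x → lookup s x ≡ free × Config b (s [ x ]≔ enforcer) (l + u) (L [ i ]≔ 0)
enforcer-break (live {u = u} {s₂ = s₂} s₁ ne e c) zero refl with y , h ← ∃-free s₁ e =
  y ↑ˡ _ , trans (lookup-++ˡ s₁ s₂ y) h ,
  subst (λ s → Config _ s _ _) (sym ([]≔-++-↑ˡ s₁ s₂ y)) (dead (s₁ [ y ]≔ enforcer)
    (cong (_+ u) (suc-injective (trans (sym e) (nfree-claim s₁ y (λ ()) h)))) c)
enforcer-break (live {s₂ = s₂} s₁ ne e c) (suc i) eq with y , h , c′ ← enforcer-break c i eq =
  _ ↑ʳ y , trans (lookup-++ʳ s₁ s₂ y) h ,
  subst (λ s → Config _ s _ _) (sym ([]≔-++-↑ʳ s₁ s₂ y)) (live s₁ ne e c′)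
enforcer-break {l = l} (dead {u = u} {s₂ = s₂} s₁ refl c) (suc i) eq
  with y , h , c′ ← enforcer-break c i eq =
  _ ↑ʳ y , trans (lookup-++ʳ s₁ s₂ y) h ,
  subst (λ s → Config _ s _ _) (sym ([]≔-++-↑ʳ s₁ s₂ y)) (dead s₁ swap c′)
  where
  swap : l + (nfree s₁ + u) ≡ nfree s₁ + (l + u)
  swap = trans (sym (+-assoc l _ u)) (trans (cong (_+ u) (+-comm l _)) (+-assoc (nfree s₁) l u))

-- Taking the last free element of a box in play is fatal because Enforcer has no mark there;
-- `inside-claim` therefore needs two free elements.
data AvoiderClaim {n} (b : Vec ℕ n) (s : Position (sum b)) : ℕ → Vec ℕ n → Set where
  outside-claim : ∀ {u L} → Config b s u L → AvoiderClaim b s (suc u) L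
  inside-claim  : ∀ {u l L} i → lookup L i ≡ suc (suc l) → Config b s u (L [ i ]≔ suc l) →
                  AvoiderClaim b s u L
  fatal-claim   : ∀ {u L} → AvoiderOwnsTarget (lookup (boxes b)) s → AvoiderClaim b s u L

avoider-claim : ∀ {n u} {b L : Vec ℕ n} {s} → Config b s u L → ∀ x → lookup s x ≡ free →
                AvoiderClaim b (s [ x ]≔ avoider) u L
avoider-claim (dead {x = k} {u = u} {s₂ = s₂} s₁ e c) z h with splitAt k z in eq
... | inj₁ y with refl ← splitAt⁻¹-↑ˡ eq
    rewrite e | nfree-claim {o = avoider} s₁ y (λ ()) (trans (sym (lookup-++ˡ s₁ s₂ y)) h)
          | []≔-++-↑ˡ {x = avoider} s₁ s₂ y =
      outside-claim (dead (s₁ [ y ]≔ avoider) refl c)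
... | inj₂ y with refl ← splitAt⁻¹-↑ʳ {m = k} eq
    rewrite []≔-++-↑ʳ {y = avoider} s₁ s₂ y
    with avoider-claim c y (trans (sym (lookup-++ʳ s₁ s₂ y)) h)
...   | outside-claim {u = u′} c′ rewrite e | +-suc (nfree s₁) u′ = outside-claim (dead s₁ refl c′)
...   | inside-claim i l c′ = inside-claim (suc i) l (dead s₁ e c′)
...   | fatal-claim w       = fatal-claim (owned-tail s₁ _ w)
avoider-claim (live {x = k} {l = l} {s₂ = s₂} s₁ ne e c) z h with splitAt k z in eq
... | inj₂ y with refl ← splitAt⁻¹-↑ʳ {m = k} eq
    rewrite []≔-++-↑ʳ {y = avoider} s₁ s₂ y
    with avoider-claim c y (trans (sym (lookup-++ʳ s₁ s₂ y)) h)
...   | outside-claim c′    = outside-claim (live s₁ ne e c′)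
...   | inside-claim i l c′ = inside-claim (suc i) l (live s₁ ne e c′)
...   | fatal-claim w       = fatal-claim (owned-tail s₁ _ w)
avoider-claim (live {x = k} {l = l} {s₂ = s₂} s₁ ne e c) z h | inj₁ y
    with refl ← splitAt⁻¹-↑ˡ eq
    rewrite []≔-++-↑ˡ {x = avoider} s₁ s₂ y
    with left ← suc-injective (trans (sym e)
                  (nfree-claim {o = avoider} s₁ y (λ ()) (trans (sym (lookup-++ˡ s₁ s₂ y)) h)))
    with l
... | zero   = fatal-claim (owned-head (s₁ [ y ]≔ avoider) s₂
                 (all-avoider (s₁ [ y ]≔ avoider) (sym left) (avoider≢enforcer s₁ y ne)))
... | suc l′ = inside-claim zero refl
                 (live (s₁ [ y ]≔ avoider) (avoider≢enforcer s₁ y ne) (sym left) c)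

-- From an invariant to a win

-- An invariant of the strategy "claim abandoned elements while there are any, then abandon
-- a box with the most free elements".
record Invariant (p q n : ℕ) : Set₁ where
  field
    Inv         : Player → ℕ → ℕ → Vec ℕ n → Set
    nonempty    : ∀ {σ j u L} → Inv σ j u L → ∃₂ λ i l → lookup L i ≡ suc l
    E-outside   : ∀ {j u L} → Inv E (suc j) (suc u) L → Inv E j u L
    E-break     : ∀ {j l L} i → (∀ i′ → lookup L i′ ≤ lookup L i) → lookup L i ≡ suc l →
                  Inv E (suc j) 0 L → Inv E j l (L [ i ]≔ 0)
    A-outside   : ∀ {j u L} → Inv A (suc j) (suc u) L → Inv A j u L
    A-inside    : ∀ {j u l L} i → lookup L i ≡ suc (suc l) →
                  Inv A (suc j) u L → Inv A j u (L [ i ]≔ suc l)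
    E-pass      : ∀ {u L} → Inv E 0 u L → Inv A p u L
    A-pass      : ∀ {u L} → Inv A 0 u L → Inv E q u L

argmax : ∀ {n} (L : Vec ℕ (suc n)) → ∃ λ i → ∀ i′ → lookup L i′ ≤ lookup L i
argmax (x ∷ [])        = zero , λ { zero → ≤-refl }
argmax (x ∷ L@(_ ∷ _)) with i , max ← argmax L | ≤-total x (lookup L i)
... | inj₁ x≤ = suc i , λ { zero → x≤ ; (suc j) → max j }
... | inj₂ ≥x = zero  , λ { zero → ≤-refl ; (suc j) → ≤-trans (max j) ≥x }

argmax-positive : ∀ {n l} (L : Vec ℕ n) i → lookup L i ≡ suc l →
                  ∃₂ λ j m → (∀ i′ → lookup L i′ ≤ lookup L j) × lookup L j ≡ suc m
argmax-positive L@(_ ∷ _) i e with j , max ← argmax L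
  with m , e′ ← positive⇒suc (≤-trans (s≤s z≤n) (≤-trans (≤-reflexive (sym e)) (max i))) =
  j , m , max , e′

module _ {p q n : ℕ} (0<p : 0 < p) (0<q : 0 < q) {b : Vec ℕ n} where

  private
    Wins : Player → ℕ → Position (sum b) → Set
    Wins = Play p q (lookup (boxes b))

    Owned : Position (sum b) → Set
    Owned = AvoiderOwnsTarget (lookup (boxes b))

  -- Once a box is lost to Avoider, the rest of the game only has to be played out, by induction on
  -- the number f of free elements. A pass does not lower f; as both biases are positive, it is
  -- treated together with the claim that follows it.
  owned⇒play   : ∀ f σ j s → nfree s ≡ f → Owned s → Wins σ j s
  owned⇒play-E : ∀ f j s → nfree s ≡ suc f → Owned s → Wins E (suc j) s
  owned⇒play-A : ∀ f j s → nfree s ≡ suc f → Owned s → Wins A (suc j) s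

  owned⇒play-E f j s e w with x , h ← ∃-free s e =
    claim-E x h (owned⇒play f E j _ (suc-injective (trans (sym (nfree-claim s x (λ ()) h)) e))
                              (owned-persists s x h w))
  owned⇒play-A f j s e w = claim-A (subst (0 <_) (sym e) (s≤s z≤n)) λ x h →
    owned⇒play f A j _ (suc-injective (trans (sym (nfree-claim s x (λ ()) h)) e))
                       (owned-persists s x h w)

  owned⇒play zero    σ j       s e w = over e w
  owned⇒play (suc f) E (suc j) s e w = owned⇒play-E f j s e w
  owned⇒play (suc f) A (suc j) s e w = owned⇒play-A f j s e w
  owned⇒play (suc f) E zero    s e w with j , refl ← positive⇒suc 0<p =
    pass-E (owned⇒play-A f j s e w)
  owned⇒play (suc f) A zero    s e w with j , refl ← positive⇒suc 0<q =
    pass-A (owned⇒play-E f j s e w)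

  module _ (I : Invariant p q n) where
    open Invariant I

    private
      some-free : ∀ {σ j u L s} → Config b s u L → Inv σ j u L → 0 < nfree s
      some-free {s = s} c inv with i , l , e ← nonempty inv with x , h , _ ← enforcer-break c i e =
        subst (0 <_) (sym (nfree-claim {o = enforcer} s x (λ ()) h)) (s≤s z≤n)

    -- Induction on the number f of free elements. Under the invariant f is positive, because a box
    -- in play remains; so play can leave the invariant only by a fatal claim, after which
    -- `owned⇒play` takes over.
    invariant⇒play   : ∀ f σ j {u L s} → nfree s ≡ f → Config b s u L → Inv σ j u L → Wins σ j s
    invariant⇒play-E : ∀ f j {u L s} → nfree s ≡ suc f → Config b s u L →
                       Inv E (suc j) u L → Wins E (suc j) s
    invariant⇒play-A : ∀ f j {u L s} → nfree s ≡ suc f → Config b s u L →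
                       Inv A (suc j) u L → Wins A (suc j) s

    invariant⇒play-E f j {suc u} {L} {s} e c inv with x , h , c′ ← enforcer-outside c =
      claim-E x h (invariant⇒play f E j
        (suc-injective (trans (sym (nfree-claim s x (λ ()) h)) e)) c′ (E-outside inv))
    invariant⇒play-E f j {zero} {L} {s} e c inv
      with i , l , eᵢ ← nonempty inv
      with i , l , max , eᵢ ← argmax-positive L i eᵢ
      with x , h , c′ ← enforcer-break c i eᵢ =
      claim-E x h (invariant⇒play f E j
        (suc-injective (trans (sym (nfree-claim s x (λ ()) h)) e))
        (subst (λ u → Config b _ u _) (+-identityʳ l) c′) (E-break i max eᵢ inv))

    invariant⇒play-A f j {u} {L} {s} e c inv = claim-A (subst (0 <_) (sym e) (s≤s z≤n)) reply
      where
      reply : ∀ x → lookup s x ≡ free → Wins A j (s [ x ]≔ avoider)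
      reply x h with e′ ← suc-injective (trans (sym (nfree-claim s x (λ ()) h)) e)
        with avoider-claim c x h
      ... | outside-claim c′     = invariant⇒play f A j e′ c′ (A-outside inv)
      ... | inside-claim i eᵢ c′ = invariant⇒play f A j e′ c′ (A-inside i eᵢ inv)
      ... | fatal-claim w        = owned⇒play f A j _ e′ w

    invariant⇒play zero    σ j       e c inv = contradiction (sym e) (<⇒≢ (some-free c inv))
    invariant⇒play (suc f) E (suc j) e c inv = invariant⇒play-E f j e c inv
    invariant⇒play (suc f) A (suc j) e c inv = invariant⇒play-A f j e c inv
    invariant⇒play (suc f) E zero    e c inv with j , refl ← positive⇒suc 0<p =
      pass-E (invariant⇒play-A f j e c (E-pass inv))
    invariant⇒play (suc f) A zero    e c inv with j , refl ← positive⇒suc 0<q =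
      pass-A (invariant⇒play-E f j e c (A-pass inv))

-- Values of boxes and the initial position

replicate-++ : ∀ x {y} → replicate x free ++ replicate y free ≡ replicate (x + y) free
replicate-++ zero    = refl
replicate-++ (suc x) = cong (free ∷_) (replicate-++ x)

nfree-replicate : ∀ x → nfree (replicate x free) ≡ x
nfree-replicate zero    = refl
nfree-replicate (suc x) = cong suc (nfree-replicate x)

module Potential (w′ k : ℕ) where

  value : ℕ → ℕ
  value f = suc w′ ^ (k ∸ f)

  weight : ℕ → ℕ
  weight zero    = 0
  weight (suc f) = value (suc f)

  potential : ∀ {n} → Vec ℕ n → ℕ
  potential L = sum (map weight L)

  value-antitone : ∀ {f s} → f ≤ s → value s ≤ value f
  value-antitone f≤s = ^-monoʳ-≤ (suc w′) (∸-monoʳ-≤ k f≤s)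

  value-pred : ∀ {f} → suc f ≤ k → value f ≡ suc w′ * value (suc f)
  value-pred {f} (s≤s f≤k) = cong (suc w′ ^_) (+-∸-assoc 1 f≤k)

  potential-update : ∀ {n} (L : Vec ℕ n) i v →
                     potential (L [ i ]≔ v) + weight (lookup L i) ≡ potential L + weight v
  potential-update (x ∷ L) zero    v = swap (weight v) (potential L) (weight x)
    where
    swap : ∀ a b c → a + b + c ≡ c + b + a
    swap = solve-∀
  potential-update (x ∷ L) (suc i) v = trans (+-assoc (weight x) _ _)
    (trans (cong (weight x +_) (potential-update L i v)) (sym (+-assoc (weight x) _ _)))

  potential-break : ∀ {n l} (L : Vec ℕ n) i → lookup L i ≡ suc l →
                    potential (L [ i ]≔ 0) + value (suc l) ≡ potential L
  potential-break {l = l} L i e = trans (cong (λ x → potential (L [ i ]≔ 0) + weight x) (sym e))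
    (trans (potential-update L i 0) (+-identityʳ _))

  -- The claim multiplies the value of the box by `suc w′`, so it adds `w′` times the old value,
  -- which is at least `value s` because smaller boxes are worth more.
  potential-touch : ∀ {n l s} (L : Vec ℕ n) i → lookup L i ≡ suc (suc l) →
                    suc (suc l) ≤ s → s ≤ k →
                    potential L + w′ * value s ≤ potential (L [ i ]≔ suc l)
  potential-touch {l = l} {s} L i e l≤s s≤k = +-cancelʳ-≤ v _ _ (begin
    potential L + w′ * value s + v
      ≤⟨ +-monoˡ-≤ v (+-monoʳ-≤ (potential L) (*-monoʳ-≤ w′ (value-antitone l≤s))) ⟩
    potential L + w′ * v + v         ≡⟨ shuffle (potential L) (w′ * v) v ⟩
    potential L + suc w′ * v         ≡⟨ cong (potential L +_) (value-pred (≤-trans l≤s s≤k)) ⟨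
    potential L + value (suc l)      ≡⟨ potential-update L i (suc l) ⟨
    potential (L [ i ]≔ suc l) + weight (lookup L i)
      ≡⟨ cong (λ x → potential (L [ i ]≔ suc l) + weight x) e ⟩
    potential (L [ i ]≔ suc l) + v   ∎)
    where
    open ≤-Reasoning
    v = value (suc (suc l))
    shuffle : ∀ a b c → a + b + c ≡ a + (c + b)
    shuffle = solve-∀

  positive-entry : ∀ {n} (L : Vec ℕ n) → 0 < potential L → ∃₂ λ i l → lookup L i ≡ suc l
  positive-entry (zero  ∷ L) pos with i , l , e ← positive-entry L pos = suc i , l , e
  positive-entry (suc l ∷ L) pos = zero , l , refl

  -- The entry 0 marks a box as abandoned, so boxes larger than k are given up before the first
  -- move.
  truncate : ℕ → ℕ
  truncate x with x ≤? k
  ... | yes _ = x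
  ... | no  _ = 0

  truncate≤ : ∀ x → truncate x ≤ k
  truncate≤ x with x ≤? k
  ... | yes x≤k = x≤k
  ... | no  _   = z≤n

  1≤weight∘truncate : ∀ {x} → 1 ≤ x → x ≤ k → 1 ≤ weight (truncate x)
  1≤weight∘truncate {suc x} _ x≤k with suc x ≤? k
  ... | yes _   = m^n>0 (suc w′) (k ∸ suc x)
  ... | no  x≰k = contradiction x≤k x≰k

  -- Each of the first N boxes survives truncation, and its value, a power of `suc w′`, is at least
  -- 1.
  count≤potential : ∀ {n} N (b : Vec ℕ n) → N ≤ n →
                    (∀ i → toℕ i < N → 1 ≤ lookup b i × lookup b i ≤ k) →
                    N ≤ potential (map truncate b)
  count≤potential zero    b       _         h = z≤n
  count≤potential (suc N) (x ∷ b) (s≤s N≤n) h with 1≤x , x≤k ← h zero (s≤s z≤n) =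
    +-mono-≤ (1≤weight∘truncate 1≤x x≤k) (count≤potential N b N≤n λ i i<N → h (suc i) (s≤s i<N))

  truncate-bound : ∀ {n} (b : Vec ℕ n) i → lookup (map truncate b) i ≤ k
  truncate-bound b i rewrite lookup-map i truncate b = truncate≤ (lookup b i)

  initial-config : ∀ {n} (b : Vec ℕ n) → ∃ λ u → Config b (emptyPosition (sum b)) u (map truncate b)
  initial-config []      = 0 , []
  initial-config (x ∷ b) with u , c ← initial-config b with truncate x in e
  ... | zero  = _ , subst (λ s → Config _ s _ _) (replicate-++ x) (dead (replicate x free) refl c)
  ... | suc l = _ , subst (λ s → Config _ s _ _) (replicate-++ x) (live (replicate x free)
      (λ y h → contradiction (trans (sym h) (lookup-replicate y free)) λ ())
      (trans (nfree-replicate x) (truncate-suc x e)) c)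
    where
    truncate-suc : ∀ x {l} → truncate x ≡ suc l → x ≡ suc l
    truncate-suc x e with x ≤? k
    ... | yes _ = e

update-bound : ∀ {n s v} (L : Vec ℕ n) i → (∀ i′ → lookup L i′ ≤ s) → v ≤ s →
               ∀ i′ → lookup (L [ i ]≔ v) i′ ≤ s
update-bound {v = v} L i bound v≤s i′ with i′ F.≟ i
... | yes refl = subst (_≤ _) (sym (lookup∘update i L v)) v≤s
... | no  i′≢i = subst (_≤ _) (sym (lookup∘update′ i′≢i L v)) (bound i′)

-- The invariant for k > p

module Large {p q k : ℕ} (n w′ : ℕ) (w′≥ : p + q ≤ w′)
  (window : ∀ {l j} → suc l ≤ k → j < q → ∃ λ m → ∃₂ λ J e →
            suc m ≤ p + q × e < p × suc m * suc l ≡ e + J * (p + q) + suc j) where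

  open Potential w′ k
  open ≤-Reasoning

  reserve : ℕ → ℕ
  reserve zero    = 0
  reserve (suc s) = (p + q) * value (suc s) + reserve s

  reserve-mono : ∀ {r s} → r ≤ s → reserve r ≤ reserve s
  reserve-mono {s = zero}  z≤n = z≤n
  reserve-mono {s = suc s} r≤s with m≤n⇒m<n∨m≡n r≤s
  ... | inj₁ (s≤s r≤s′) = ≤-trans (reserve-mono r≤s′) (m≤n+m _ _)
  ... | inj₂ refl       = ≤-refl

  -- As `p + q < suc w′`, even `p + q + 1` boxes of one size are worth no more than one box with one
  -- free element fewer, so the sum telescopes down to size 0.
  reserve≤ : ∀ s → s ≤ k → reserve s + value s ≤ value 0
  reserve≤ zero    _   = ≤-refl
  reserve≤ (suc s) s<k = begin
    (p + q) * v + reserve s + v ≡⟨ shuffle (p + q) v (reserve s) ⟩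
    reserve s + suc (p + q) * v ≤⟨ +-monoʳ-≤ (reserve s) (*-monoˡ-≤ v (s≤s w′≥)) ⟩
    reserve s + suc w′ * v      ≡⟨ cong (reserve s +_) (value-pred s<k) ⟨
    reserve s + value s         ≤⟨ reserve≤ s (<⇒≤ s<k) ⟩
    value 0                     ∎
    where
    v = value (suc s)
    shuffle : ∀ P v r → P * v + r + v ≡ r + (v + P * v)
    shuffle = solve-∀

  reserve<value : reserve k < value 0
  reserve<value = ≤-trans (m<m+n (reserve k) (m^n>0 (suc w′) (k ∸ k))) (reserve≤ k ≤-refl)

  bias : Player → ℕ
  bias E = q
  bias A = p

  load : Player → ℕ → ℕ
  load E u = u
  load A u = p + u

  -- While Avoider stays on abandoned elements, these and m further boxes of s + 1 free elements
  -- supply the j claims left in the current move and J rounds of p + q claims, after which only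
  -- e < p abandoned elements remain and Avoider must claim in a box in play. In Avoider's turn
  -- his current move belongs to these J rounds, hence the extra p in 'load'. Enforcer needs the
  -- value of the m boxes for this, and 'reserve s' for the same with all smaller sizes.
  data State (σ : Player) (j u : ℕ) (L : Vec ℕ n) : Set where
    loose : ∀ s → s ≤ k → (∀ i → lookup L i ≤ s) → reserve s < potential L → State σ j u L
    tight : ∀ s m J e → suc s ≤ k → (∀ i → lookup L i ≤ suc s) →
            m * value (suc s) + reserve s < potential L → e < p →
            load σ u + m * suc s ≡ e + J * (p + q) + j → State σ j u L

  positive : ∀ {σ j u L} → State σ j u L → 0 < potential L
  positive (loose s _ _ Φ)               = ≤-<-trans z≤n Φ
  positive (tight s m _ _ _ _ Φ _ _) = ≤-<-trans z≤n Φ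

  -- `window` plans `suc m` boxes of the present maximal size; the box abandoned now is the first of
  -- them. There are at most `p + q`, so the top summand of `reserve (suc l)` pays for all.
  loose-break : ∀ {j s l L} i → (∀ i′ → lookup L i′ ≤ lookup L i) → lookup L i ≡ suc l → j < q →
                s ≤ k → (∀ i → lookup L i ≤ s) → reserve s < potential L →
                State E j l (L [ i ]≔ 0)
  loose-break {j} {s} {l} {L} i max e j<q s≤k bound Φ
    with l<s ← subst (_≤ s) e (bound i)
    with m , J , e′ , m<P , e′<p , eq ← window {l} {j} (≤-trans l<s s≤k) j<q =
    tight l m J e′ (≤-trans l<s s≤k)
      (update-bound L i (λ i′ → ≤-trans (max i′) (≤-reflexive e)) z≤n)
      (+-cancelʳ-< v _ _ (begin-strict
        m * v + reserve l + v      ≡⟨ shuffle m v (reserve l) ⟩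
        suc m * v + reserve l      ≤⟨ +-monoˡ-≤ (reserve l) (*-monoˡ-≤ v m<P) ⟩
        reserve (suc l)            ≤⟨ reserve-mono l<s ⟩
        reserve s                  <⟨ Φ ⟩
        potential L                ≡⟨ potential-break L i e ⟨
        potential (L [ i ]≔ 0) + v ∎))
      e′<p (suc-injective (trans eq (+-suc _ j)))
    where
    v = value (suc l)
    shuffle : ∀ m v r → m * v + r + v ≡ v + m * v + r
    shuffle = solve-∀

  invariant : Invariant p q n
  invariant = record
    { Inv       = λ σ j u L → j ≤ bias σ × State σ j u L
    ; nonempty  = λ {_} {_} {_} {L} (_ , S) → positive-entry L (positive S)
    ; E-outside = λ (j<q , S) → <⇒≤ j<q , E-out S
    ; E-break   = λ i max e (j<q , S) → <⇒≤ j<q , E-brk i max e j<q S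
    ; A-outside = λ (j<p , S) → <⇒≤ j<p , A-out S
    ; A-inside  = λ i e (j<p , S) → <⇒≤ j<p , A-in i e S
    ; E-pass    = λ (_ , S) → ≤-refl , E-end S
    ; A-pass    = λ (_ , S) → ≤-refl , A-end S
    }
    where
    E-out : ∀ {j u L} → State E (suc j) (suc u) L → State E j u L
    E-out (loose s s≤k bound Φ) = loose s s≤k bound Φ
    E-out (tight s m J e s≤k bound Φ e<p eq) = tight s m J e s≤k bound Φ e<p
      (suc-injective (trans eq (+-suc _ _)))

    E-brk : ∀ {j l L} i → (∀ i′ → lookup L i′ ≤ lookup L i) → lookup L i ≡ suc l → j < q →
            State E (suc j) 0 L → State E j l (L [ i ]≔ 0)
    E-brk i max e j<q (loose s s≤k bound Φ) = loose-break i max e j<q s≤k bound Φ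
    E-brk {l = l} {L} i max e j<q (tight s m J e′ s≤k bound Φ e′<p eq)
      with m≤n⇒m<n∨m≡n (s≤s⁻¹ (subst (_≤ suc s) e (bound i)))
    -- No box of size `suc s` is left in play: a new plan starts at a smaller size, paid from
    -- `reserve s`.
    ... | inj₁ l<s = loose-break i max e j<q (<⇒≤ s≤k)
                       (λ i′ → ≤-trans (max i′) (≤-trans (≤-reflexive e) l<s))
                       (≤-<-trans (m≤n+m _ _) Φ)
    -- The planned boxes cannot be used up here: with u and m both 0 the supply equation would leave
    -- no claim to make.
    E-brk {j} i max e j<q (tight s zero J e′ s≤k bound Φ e′<p eq)
        | inj₂ refl = contradiction (trans eq (+-suc _ j)) λ ()
    E-brk {j} {l} {L} i max e j<q (tight s (suc m) J e′ s≤k bound Φ e′<p eq)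
        | inj₂ refl = tight s m J e′ s≤k (update-bound L i bound z≤n)
          (+-cancelʳ-< v _ _ (begin-strict
            m * v + reserve s + v      ≡⟨ shuffle m v (reserve s) ⟩
            suc m * v + reserve s      <⟨ Φ ⟩
            potential L                ≡⟨ potential-break L i e ⟨
            potential (L [ i ]≔ 0) + v ∎))
          e′<p (suc-injective (trans eq (+-suc _ j)))
      where
      v = value (suc s)
      shuffle : ∀ m v r → m * v + r + v ≡ v + m * v + r
      shuffle = solve-∀

    A-out : ∀ {j u L} → State A (suc j) (suc u) L → State A j u L
    A-out (loose s s≤k bound Φ) = loose s s≤k bound Φ
    A-out {j} {u} (tight s m J e s≤k bound Φ e<p eq) = tight s m J e s≤k bound Φ e<p
      (suc-injective (trans (cong (_+ m * suc s) (sym (+-suc p u))) (trans eq (+-suc _ _))))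

    A-in : ∀ {j u l L} i → lookup L i ≡ suc (suc l) →
           State A (suc j) u L → State A j u (L [ i ]≔ suc l)
    A-in {L = L} i e (loose s s≤k bound Φ) with l≤s ← subst (_≤ s) e (bound i) =
      loose s s≤k (update-bound L i bound (<⇒≤ l≤s))
        (<-≤-trans Φ (≤-trans (m≤m+n _ _) (potential-touch L i e l≤s s≤k)))
    A-in {l = l} {L} i e (tight s m J e′ s≤k bound Φ _ _) with l≤s ← subst (_≤ suc s) e (bound i) =
      -- One claim in a box in play gains at least the value of `p + q` boxes of size `suc s`. This
      -- refills the reserve, and the plan is dropped.
      loose (suc s) s≤k (update-bound L i bound (<⇒≤ l≤s)) (begin-strict
        (p + q) * v + reserve s ≤⟨ +-monoˡ-≤ (reserve s) (*-monoˡ-≤ v w′≥) ⟩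
        w′ * v + reserve s      ≡⟨ +-comm (w′ * v) _ ⟩
        reserve s + w′ * v      <⟨ +-monoˡ-< (w′ * v) (≤-<-trans (m≤n+m _ _) Φ) ⟩
        potential L + w′ * v    ≤⟨ potential-touch L i e l≤s s≤k ⟩
        potential (L [ i ]≔ suc l) ∎)
      where v = value (suc s)

    E-end : ∀ {u L} → State E 0 u L → State A p u L
    E-end (loose s s≤k bound Φ) = loose s s≤k bound Φ
    E-end {u} (tight s m J e s≤k bound Φ e<p eq) = tight s m J e s≤k bound Φ e<p
      (trans (+-assoc p u _) (trans (cong (p +_) (trans eq (+-identityʳ _))) (+-comm p _)))

    A-end : ∀ {u L} → State A 0 u L → State E q u L
    A-end (loose s s≤k bound Φ) = loose s s≤k bound Φ
    -- With no planned round left, Avoider had fewer than p abandoned elements for his move, so he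
    -- cannot have completed it outside the boxes in play.
    A-end {u} (tight s m zero e s≤k bound Φ e<p eq) = contradiction e<p (≤⇒≯ (begin
      p                   ≤⟨ m≤m+n p u ⟩
      p + u               ≤⟨ m≤m+n _ (m * suc s) ⟩
      p + u + m * suc s   ≡⟨ eq ⟩
      e + 0 + 0           ≡⟨ trans (+-identityʳ _) (+-identityʳ e) ⟩
      e                   ∎))
    A-end {u} (tight s m (suc J) e s≤k bound Φ e<p eq) = tight s m J e s≤k bound Φ e<p
      (+-cancelˡ-≡ p _ _ (trans (sym (+-assoc p u _)) (trans eq (shuffle p q e (J * (p + q))))))
      where
      shuffle : ∀ p q e r → e + (p + q + r) + 0 ≡ p + (e + r + q)
      shuffle = solve-∀

-- Multiples of a box size modulo p + q

bezout% : ∀ P s .{{_ : NonZero P}} → ∃ λ x → (x * s) % P ≡ gcd P s % P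
bezout% P s with Bézout.identity (gcd-GCD P s)
... | Bézout.-+ x y eq = y , trans (cong (_% P) (sym eq)) ([m+kn]%n≡m%n (gcd P s) x P)
-- Now `y * s` is congruent to the negative of the gcd, and `P′`, which is -1 modulo P, corrects the
-- sign.
bezout% P@(suc P′) s | Bézout.+- x y eq = y * P′ , (begin
  (y * P′ * s) % P                ≡⟨ [m+kn]%n≡m%n (y * P′ * s) x P ⟨
  (y * P′ * s + x * P) % P        ≡⟨ cong (λ z → (y * P′ * s + z) % P) eq ⟨
  (y * P′ * s + (g + y * s)) % P  ≡⟨ cong (_% P) (shuffle y s g P′) ⟩
  (g + y * s * P) % P             ≡⟨ [m+kn]%n≡m%n g (y * s) P ⟩
  g % P                           ∎)
  where
  open ≡-Reasoning
  g = gcd P s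
  shuffle : ∀ y s g P′ → y * P′ * s + (g + y * s) ≡ g + y * s * suc P′
  shuffle = solve-∀

-- Since `x * s` is congruent to g, the multiplier `x * y`, reduced modulo `p + q`, takes s to the
-- residue `g * y` for any y with `g * y` below `p + q`.
progression-hits-window : ∀ {p q s j g′ x} .{{_ : NonZero (p + q)}} →
                          (x * s) % (p + q) ≡ suc g′ % (p + q) → suc g′ ≤ p → j < q →
                          ∃ λ m → ∃₂ λ J e →
                          suc m ≤ p + q × e < p × suc m * s ≡ e + J * (p + q) + suc j
progression-hits-window {p} {q} {s} {j} {g′} {x} eq g≤p j<q = result ((x * y) % P) refl
  where
  P = p + q
  g = suc g′
  -- `g * y` is `suc j` rounded up to a multiple of g, and e is the excess, at most `g′`.
  y = (suc j + g′) / g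
  e = g′ ∸ (suc j + g′) % g

  value-in-window : g * y ≡ e + suc j
  value-in-window = +-cancelʳ-≡ r _ _ (begin
    g * y + r          ≡⟨ trans (+-comm _ r) (cong (r +_) (*-comm g y)) ⟩
    r + y * g          ≡⟨ m≡m%n+[m/n]*n (suc j + g′) g ⟨
    suc j + g′         ≡⟨ cong (suc j +_) (m∸n+n≡m (s≤s⁻¹ (m%n<n (suc j + g′) g))) ⟨
    suc j + (e + r)    ≡⟨ trans (sym (+-assoc (suc j) e r)) (cong (_+ r) (+-comm (suc j) e)) ⟩
    e + suc j + r      ∎)
    where
    open ≡-Reasoning
    r = (suc j + g′) % g

  e<p : e < p
  e<p = ≤-trans (s≤s (m∸n≤m g′ ((suc j + g′) % g))) g≤p

  gy<P : g * y < P
  gy<P = subst (_< P) (sym value-in-window) (+-mono-<-≤ e<p j<q)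

  product%P : ∀ m → m ≡ (x * y) % P → (m * s) % P ≡ g * y
  product%P m refl = begin
    ((x * y) % P * s) % P                  ≡⟨ %-distribˡ-* ((x * y) % P) s P ⟩
    ((x * y) % P % P * (s % P)) % P        ≡⟨ cong (λ z → (z * (s % P)) % P) (m%n%n≡m%n (x * y) P) ⟩
    ((x * y) % P * (s % P)) % P            ≡⟨ %-distribˡ-* (x * y) s P ⟨
    (x * y * s) % P                        ≡⟨ cong (_% P) (shuffle x y s) ⟩
    (x * s * y) % P                        ≡⟨ %-distribˡ-* (x * s) y P ⟩
    ((x * s) % P * (y % P)) % P            ≡⟨ cong (λ z → (z * (y % P)) % P) eq ⟩
    (g % P * (y % P)) % P                  ≡⟨ %-distribˡ-* g y P ⟨
    (g * y) % P                            ≡⟨ m<n⇒m%n≡m gy<P ⟩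
    g * y                                  ∎
    where
    open ≡-Reasoning
    shuffle : ∀ x y s → x * y * s ≡ x * s * y
    shuffle = solve-∀

  result : ∀ m → m ≡ (x * y) % P →
           ∃ λ m → ∃₂ λ J e → suc m ≤ P × e < p × suc m * s ≡ e + J * P + suc j
  -- The multiplier 0 would give the residue 0, but `g * y` is at least `suc j`.
  result zero    m≡ = contradiction
    (trans (sym (m*n%n≡0 0 P)) (trans (product%P 0 m≡) (trans value-in-window (+-suc e j)))) λ ()
  result (suc m) m≡ = m , J , e , ≤-trans (≤-reflexive m≡) (<⇒≤ (m%n<n (x * y) P)) , e<p , (begin
    suc m * s               ≡⟨ m≡m%n+[m/n]*n (suc m * s) P ⟩
    (suc m * s) % P + J * P ≡⟨ cong (_+ J * P) (trans (product%P (suc m) m≡) value-in-window) ⟩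
    e + suc j + J * P       ≡⟨ shuffle e (suc j) (J * P) ⟩
    e + J * P + suc j       ∎)
    where
    open ≡-Reasoning
    J = (suc m * s) / P
    shuffle : ∀ a b c → a + b + c ≡ a + c + b
    shuffle = solve-∀

-- The multiples of s are, modulo p + q, the multiples of gcd (p + q) s ≤ p, so one of them
-- lies in the window j + 1, …, j + p of length p.
multiple-in-window : ∀ {p q s j} .{{_ : NonZero p}} → gcd (p + q) s ≤ p → j < q →
                     ∃ λ m → ∃₂ λ J e →
                     suc m ≤ p + q × e < p × suc m * s ≡ e + J * (p + q) + suc j
multiple-in-window {p@(suc _)} {q} {s} g≤p j<q
  with x , eq ← bezout% (p + q) s
  with g′ , g≡ ← positive⇒suc (n≢0⇒n>0 λ e →
                   contradiction (gcd[m,n]≡0⇒m≡0 {p + q} {s} e) λ ()) =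
  progression-hits-window {g′ = g′} {x} (trans eq (cong (_% (p + q)) g≡))
    (subst (_≤ p) g≡ g≤p) j<q

-- The invariant for k ≤ p

module Small {p q k′ c : ℕ} (n : ℕ) (k≤p : suc k′ ≤ p) (q≤cp : q ≤ c * p) where

  w′ k : ℕ
  w′ = c + 2
  k  = suc k′

  open Potential w′ k
  open ≤-Reasoning

  -- The worth of `q + 1` boxes with one free element, the most valuable kind: a move abandoning at
  -- most q boxes cannot exhaust it.
  threshold : ℕ
  threshold = suc q * value 1

  -- A debt of d is incurred by abandoning d boxes within one move, all of whose values are at
  -- most that of a box with s + 1 free elements, the size of the last one. Then at most s
  -- abandoned elements are left, so Avoider has to touch boxes of value at least
  -- value (suc s); t counts how often he did so.
  data State : Player → ℕ → ℕ → Vec ℕ n → Set where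
    solvent : ∀ {σ j u L} → (∀ i → lookup L i ≤ k) → threshold ≤ potential L → State σ j u L
    debt-E  : ∀ {j u L} s d → suc s ≤ k → (∀ i → lookup L i ≤ suc s) →
              threshold ≤ potential L + d * value (suc s) →
              u ≤ s → d * suc s + j ≤ u + q → State E j u L
    debt-A  : ∀ {j u L} s d t → suc s ≤ k → (∀ i → lookup L i ≤ suc s) →
              threshold + t * (w′ * value (suc s)) ≤ potential L + d * value (suc s) →
              u + p ≤ j + t + s → d * suc s ≤ s + q → State A j u L

  -- The hypothesis counts elements: the d abandoned boxes had at least `suc s` free elements each,
  -- at most s of these remain, and one move claims at most q. It fails for `q + 1` boxes, since
  -- `(q + 1) * suc s > s + q`.
  d≤q : ∀ {s d} → d * suc s ≤ s + q → d ≤ q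
  d≤q {s} {d} h = ≮⇒≥ λ q<d → <⇒≱ (begin-strict
    s + q             <⟨ n<1+n _ ⟩
    suc s + q         ≤⟨ +-monoʳ-≤ (suc s) (m≤m*n q (suc s)) ⟩
    suc q * suc s     ≤⟨ *-monoˡ-≤ (suc s) q<d ⟩
    d * suc s         ∎) h

  potential>0 : ∀ {s d} {L : Vec ℕ n} → d * suc s ≤ s + q →
                threshold ≤ potential L + d * value (suc s) → 0 < potential L
  potential>0 {s} {d} {L} h Φ = +-cancelʳ-< (d * value (suc s)) _ _ (begin-strict
    d * value (suc s)
      ≤⟨ *-mono-≤ (d≤q {s} {d} h) (value-antitone (s≤s (z≤n {s}))) ⟩
    q * value 1                          <⟨ m<n+m (q * value 1) (m^n>0 (suc w′) k′) ⟩
    threshold                            ≤⟨ Φ ⟩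
    potential L + d * value (suc s)      ∎)

  positive : ∀ {σ j u L} → State σ j u L → 0 < potential L
  positive (solvent _ Φ) = <-≤-trans (≤-trans (m^n>0 (suc w′) k′) (m≤m+n _ _)) Φ
  positive {L = L} (debt-E s d _ _ Φ u≤s h) =
    potential>0 {s} {d} {L} (≤-trans (m≤m+n _ _) (≤-trans h (+-monoˡ-≤ q u≤s))) Φ
  positive {L = L} (debt-A s d t _ _ Φ _ h) = potential>0 {s} {d} {L} h (≤-trans (m≤m+n _ _) Φ)

  -- Avoider found at most s abandoned elements and `s < k ≤ p`, so t is positive. Then p ≤ t + s ≤
  -- t (s + 1), and `q ≤ c * p` turns the bound s + q on d (s + 1) into at most (c + 2) t (s + 1).
  repaid : ∀ {s d t u} → suc s ≤ k → u + p ≤ t + s → d * suc s ≤ s + q → d ≤ t * w′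
  repaid {s} {d} {zero}    {u} s<k h _ = contradiction (≤-trans (m≤n+m p u) h)
    (<⇒≱ (≤-trans s<k k≤p))
  repaid {s} {d} {t@(suc t′)} {u} s<k h debt = *-cancelʳ-≤ d (t * w′) (suc s) (begin
    d * suc s                            ≤⟨ debt ⟩
    s + q                                ≤⟨ +-mono-≤ s≤ (≤-trans q≤cp (*-monoʳ-≤ c p≤)) ⟩
    2 * (t * suc s) + c * (t * suc s)    ≡⟨ shuffle t c (suc s) ⟩
    t * w′ * suc s                       ∎)
    where
    p≤ : p ≤ t * suc s
    p≤ = begin
      p                    ≤⟨ m≤n+m p u ⟩
      u + p                ≤⟨ h ⟩
      t + s                ≡⟨ trans (+-comm t s) (+-suc s t′) ⟩
      suc s + t′           ≤⟨ +-monoʳ-≤ (suc s) (m≤m*n t′ (suc s)) ⟩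
      t * suc s            ∎
    s≤ : s ≤ 2 * (t * suc s)
    s≤ = ≤-trans (n≤1+n s) (≤-trans (m≤n*m (suc s) t) (m≤n*m (t * suc s) 2))
    shuffle : ∀ t c s → 2 * (t * s) + c * (t * s) ≡ t * (c + 2) * s
    shuffle = solve-∀

  bias : Player → ℕ
  bias E = q
  bias A = p

  invariant : Invariant p q n
  invariant = record
    { Inv       = λ σ j u L → j ≤ bias σ × State σ j u L
    ; nonempty  = λ {_} {_} {_} {L} (_ , S) → positive-entry L (positive S)
    ; E-outside = λ (j<q , S) → <⇒≤ j<q , E-out S
    ; E-break   = λ i max e (j<q , S) → <⇒≤ j<q , E-brk i max e j<q S
    ; A-outside = λ (j<p , S) → <⇒≤ j<p , A-out S
    ; A-inside  = λ i e (j<p , S) → <⇒≤ j<p , A-in i e S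
    ; E-pass    = λ (_ , S) → ≤-refl , E-end S
    ; A-pass    = λ (_ , S) → ≤-refl , A-end S
    }
    where
    E-out : ∀ {j u L} → State E (suc j) (suc u) L → State E j u L
    E-out (solvent bound Φ)              = solvent bound Φ
    E-out {j} (debt-E s d s<k bound Φ u≤s h) = debt-E s d s<k bound Φ (<⇒≤ u≤s)
      (s≤s⁻¹ (≤-trans (≤-reflexive (sym (+-suc _ j))) h))

    E-brk : ∀ {j l L} i → (∀ i′ → lookup L i′ ≤ lookup L i) → lookup L i ≡ suc l → j < q →
            State E (suc j) 0 L → State E j l (L [ i ]≔ 0)
    E-brk {j} {l} {L} i max e j<q (solvent bound Φ) = debt-E l 1 (subst (_≤ k) e (bound i))
      (update-bound L i (λ i′ → ≤-trans (max i′) (≤-reflexive e)) z≤n)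
      (begin
        threshold                                        ≤⟨ Φ ⟩
        potential L                                      ≡⟨ potential-break L i e ⟨
        potential (L [ i ]≔ 0) + value (suc l)
          ≡⟨ cong (potential (L [ i ]≔ 0) +_) (+-identityʳ _) ⟨
        potential (L [ i ]≔ 0) + 1 * value (suc l)       ∎)
      ≤-refl
      (begin
        1 * suc l + j   ≡⟨ trans (cong (_+ j) (+-identityʳ (suc l))) (sym (+-suc l j)) ⟩
        l + suc j       ≤⟨ +-monoʳ-≤ l j<q ⟩
        l + q           ∎)
    E-brk {j} {l} {L} i max e j<q (debt-E s d s<k bound Φ u≤s h) =
      debt-E l (suc d) (≤-trans l≤s s<k)
      (update-bound L i (λ i′ → ≤-trans (max i′) (≤-reflexive e)) z≤n)
      (begin
        threshold                                 ≤⟨ Φ ⟩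
        potential L + d * value (suc s)
          -- The earlier boxes of the debt are revalued at the current size, which is no larger and
          -- hence worth no less.
          ≤⟨ +-monoʳ-≤ (potential L) (*-monoʳ-≤ d (value-antitone l≤s)) ⟩
        potential L + d * v                       ≡⟨ cong (_+ d * v) (potential-break L i e) ⟨
        potential (L [ i ]≔ 0) + v + d * v        ≡⟨ +-assoc (potential (L [ i ]≔ 0)) v _ ⟩
        potential (L [ i ]≔ 0) + suc d * v        ∎)
      ≤-refl
      (begin
        suc d * suc l + j          ≡⟨ shuffle l (d * suc l) j ⟩
        l + (d * suc l + suc j)    ≤⟨ +-monoʳ-≤ l (+-monoˡ-≤ (suc j) (*-monoʳ-≤ d l≤s)) ⟩
        l + (d * suc s + suc j)    ≤⟨ +-monoʳ-≤ l h ⟩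
        l + q                      ∎)
      where
      v = value (suc l)
      l≤s = subst (_≤ suc s) e (bound i)
      shuffle : ∀ l a j → suc l + a + j ≡ l + (a + suc j)
      shuffle = solve-∀

    A-out : ∀ {j u L} → State A (suc j) (suc u) L → State A j u L
    A-out (solvent bound Φ)                  = solvent bound Φ
    A-out (debt-A s d t s<k bound Φ h debt) = debt-A s d t s<k bound Φ (s≤s⁻¹ h) debt

    A-in : ∀ {j u l L} i → lookup L i ≡ suc (suc l) →
           State A (suc j) u L → State A j u (L [ i ]≔ suc l)
    A-in {L = L} i e (solvent bound Φ) with l≤k ← subst (_≤ k) e (bound i) =
      solvent (update-bound L i bound (<⇒≤ l≤k))
        (≤-trans Φ (≤-trans (m≤m+n _ _) (potential-touch L i e l≤k ≤-refl)))
    A-in {j} {u} {l} {L} i e (debt-A s d t s<k bound Φ h debt)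
      with l≤s ← subst (_≤ suc s) e (bound i) =
      debt-A s d (suc t) s<k (update-bound L i bound (<⇒≤ l≤s))
        (begin
          threshold + suc t * (w′ * v)            ≡⟨ shuffle threshold (w′ * v) (t * (w′ * v)) ⟩
          threshold + t * (w′ * v) + w′ * v       ≤⟨ +-monoˡ-≤ (w′ * v) Φ ⟩
          potential L + d * v + w′ * v            ≡⟨ swap (potential L) (d * v) (w′ * v) ⟩
          potential L + w′ * v + d * v
            ≤⟨ +-monoˡ-≤ (d * v) (potential-touch L i e l≤s s<k) ⟩
          potential (L [ i ]≔ suc l) + d * v      ∎)
        (≤-trans h (≤-reflexive (cong (_+ s) (sym (+-suc j t)))))
        debt
      where
      v = value (suc s)
      shuffle : ∀ a b c → a + (b + c) ≡ a + c + b
      shuffle = solve-∀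
      swap : ∀ a b c → a + b + c ≡ a + c + b
      swap = solve-∀

    E-end : ∀ {u L} → State E 0 u L → State A p u L
    E-end (solvent bound Φ)                      = solvent bound Φ
    E-end {u} (debt-E s d s<k bound Φ u≤s h) = debt-A s d 0 s<k bound
      (≤-trans (≤-reflexive (+-identityʳ _)) Φ)
      (begin
        u + p      ≤⟨ +-monoˡ-≤ p u≤s ⟩
        s + p      ≡⟨ trans (+-comm s p) (cong (_+ s) (sym (+-identityʳ p))) ⟩
        p + 0 + s  ∎)
      (≤-trans (≤-reflexive (sym (+-identityʳ _))) (≤-trans h (+-monoˡ-≤ q u≤s)))

    A-end : ∀ {u L} → State A 0 u L → State E q u L
    A-end (solvent bound Φ)                   = solvent bound Φ
    A-end {u} {L} (debt-A s d t s<k bound Φ h debt) = solvent (λ i → ≤-trans (bound i) s<k)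
      (+-cancelʳ-≤ (d * v) _ _ (begin
        threshold + d * v
          ≤⟨ +-monoʳ-≤ threshold (*-monoˡ-≤ v (repaid {s} {d} {t} s<k h debt)) ⟩
        threshold + t * w′ * v       ≡⟨ cong (threshold +_) (*-assoc t w′ v) ⟩
        threshold + t * (w′ * v)     ≤⟨ Φ ⟩
        potential L + d * v          ∎))
      where v = value (suc s)

-- The number N(k) and the two cases

ceilDiv-bound : ∀ q p .{{_ : NonZero p}} → q ≤ ceilDiv q p * p
ceilDiv-bound q p@(suc p′) = +-cancelʳ-≤ p′ _ _ (begin
  q + p′                        ≡⟨ cong (_∸ 1) (+-suc q p′) ⟨
  q + p ∸ 1                     ≡⟨ m≡m%n+[m/n]*n (q + p ∸ 1) p ⟩
  (q + p ∸ 1) % p + ceilDiv q p * p ≤⟨ +-monoˡ-≤ _ (s≤s⁻¹ (m%n<n (q + p ∸ 1) p)) ⟩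
  p′ + ceilDiv q p * p          ≡⟨ +-comm p′ _ ⟩
  ceilDiv q p * p + p′          ∎)
  where open ≤-Reasoning

Nk-small : ∀ p q .{{_ : NonZero p}} {k} → k ≤ p → Nk p q k ≡ (q + 1) * (ceilDiv q p + 3) ^ (k ∸ 1)
Nk-small p q {k} k≤p with k ≤ᵇ p | ≤⇒≤ᵇ k≤p
... | true | _ = refl

Nk-large : ∀ p q .{{_ : NonZero p}} {k} → ¬ k ≤ p → Nk p q k ≡ (2 * (p + q + 1)) ^ k
Nk-large p q {k} k≰p with k ≤ᵇ p in eq
... | true  = contradiction (≤ᵇ⇒≤ k p (subst T (sym eq) tt)) k≰p
... | false = refl

sorted-prefix : ∀ {n k N} (b : Vec ℕ n) → (∀ i j → i F.≤ j → lookup b i ≤ lookup b j) →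
                0 < N → N ≤ n → (∀ i → toℕ i ≡ N ∸ 1 → lookup b i ≤ k) →
                ∀ i → toℕ i < N → lookup b i ≤ k
sorted-prefix {N = suc N} b sorted _ N<n last i i≤N =
  ≤-trans (sorted i (fromℕ< N<n) (subst (toℕ i ≤_) (sym (toℕ-fromℕ< N<n)) (s≤s⁻¹ i≤N)))
          (last (fromℕ< N<n) (toℕ-fromℕ< N<n))

theorem2p3 : (p q : ℕ) .{{_ : NonZero p}} → 1 ≤ q →
    (n t : ℕ) → t ≤ q →
    (b : Vec ℕ n) →
    (∀ i → 1 ≤ lookup b i) →
    (∀ i j → i F.≤ j → lookup b i ≤ lookup b j) →
    (Σ ℕ λ k → 1 ≤ k ×
    (∀ ℓ → 1 ≤ ℓ → ℓ ≤ k → gcd (p + q) ℓ ≤ p) ×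
    Nk p q k ≤ n ×
    (∀ (i : Fin n) → toℕ i ≡ Nk p q k ∸ 1 → lookup b i ≤ k)) →
    EnforcerWinsMBoxFirst b p q t
theorem2p3 p q 1≤q n t t≤q b 1≤b sorted (suc k′ , _ , gcd≤p , N≤n , last) with suc k′ ≤? p
-- The shortened first move is a turn with t of at most q claims left, a situation that the
-- invariant covers.
... | yes k≤p = enforcerWins (invariant⇒play (>-nonZero⁻¹ p) 1≤q invariant _ E t refl
    (proj₂ (initial-config b)) (t≤q , solvent (truncate-bound b) enough))
  where
  open Small {c = ceilDiv q p} n k≤p (ceilDiv-bound q p)
  open Potential w′ k

  Nk≡threshold : Nk p q k ≡ threshold
  Nk≡threshold = trans (Nk-small p q k≤p)
    (cong₂ _*_ (+-comm q 1) (cong (_^ k′) (+-suc (ceilDiv q p) 2)))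

  enough : threshold ≤ potential (map truncate b)
  enough = count≤potential threshold b (subst (_≤ n) Nk≡threshold N≤n) λ i i<N → 1≤b i ,
    sorted-prefix b sorted (m≤n⇒m≤n+o _ (m^n>0 (suc w′) k′))
      (subst (_≤ n) Nk≡threshold N≤n)
      (λ i e → last i (trans e (cong (_∸ 1) (sym Nk≡threshold)))) i i<N
... | no  k≰p = enforcerWins (invariant⇒play (>-nonZero⁻¹ p) 1≤q invariant _ E t refl
    (proj₂ (initial-config b))
    (t≤q , loose k ≤-refl (truncate-bound b) (<-≤-trans reserve<value enough)))
  where
  k = suc k′
  -- Chosen so that `suc w′` is `2 * (p + q + 1)`, the base of the power N(k).
  w′ = p + q + 1 + (p + q)

  open Large {p} {q} {k} n w′ (m≤n+m (p + q) (p + q + 1))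
    (λ l<k → multiple-in-window (gcd≤p _ (s≤s z≤n) l<k))
  open Potential w′ k

  Nk≡value : Nk p q k ≡ value 0
  Nk≡value = trans (Nk-large p q k≰p) (cong (_^ k) (double (p + q)))
    where
    double : ∀ P → 2 * (P + 1) ≡ suc (P + 1 + P)
    double = solve-∀

  enough : value 0 ≤ potential (map truncate b)
  enough = count≤potential (value 0) b (subst (_≤ n) Nk≡value N≤n) λ i i<N → 1≤b i ,
    sorted-prefix b sorted (m^n>0 (suc w′) k) (subst (_≤ n) Nk≡value N≤n)
      (λ i e → last i (trans e (cong (_∸ 1) (sym Nk≡value)))) i i<N
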